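{- Let $n, K, M \ge 1$ be integers with $n = KM$, and consider the non-corrupted parallel mixnet (buffer shuffling) process on $n$ cards with $M$ servers, each shuffling $K$ cards per round, with potential $\Phi(t)=\left(\sum_{i=1}^n w_i(t)^2\right)-\frac1n$ after $t$ rounds. Then for every integer $t\ge 0$, $$\mathbf{E}[\Phi(t)] \le K^{ -t}.$$ In particular, if $K \ge n^{1/c}$ for a constant $c\ge 1$, then for any fixed $b\ge 1$, after $t=\lceil bc\rceil$ rounds the expected sum-of-squares error between the card-assignment probabilities and the uniform distribution satisfies $\mathbf{E}[\Phi(t)] \le 1/n^b$.
   Context: Buffer shuffling / non-corrupted parallel mixnet: there are $n$ cards (messages). In each round, (1) the cards are placed in order according to a uniformly random permutation, independent of all previous randomness, which the adversary sees; (2) under this ordering the cards are divided into $M=n/K$ consecutive groups of $K$ cards (one group per server); (3) within each group the $K$ cards are permuted uniformly at random, hidden from the adversary. The adversary knows the initial ordering. $w_i(t)$ is the probability, from the point of view of the adversary (i.e. given the visible permutations of rounds $1,\dots,t$), that the card in position $i$ after $t$ rounds is the card that was first at time $0$. Concretely, $w(0)=(1,0,\dots,0)$, and $w(t+1)$ is obtained from $w(t)$ by permuting the entries by a fresh uniformly random permutation of the $n$ positions, splitting the positions into $M$ consecutive blocks of size $K$, and replacing every entry in each block by the average of the $K$ entries of that block. The sum-of-squares metric is $\Phi(t)=\sum_{i=1}^n (w_i(t)-1/n)^2 = \left(\sum_{i=1}^n w_i(t)^2\right)-1/n$. It is a random variable depending on the visible random permutations; $\mathbf{E}$ is expectation over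 these. -}

module Defs where

open import Algebra.Properties.Monoid.Sum using (sum)
open import Data.Fin.Base using (Fin; zero; toℕ; quotient; combine; punchIn)
open import Data.Fin.Permutation
  using (Permutation′; _⟨$⟩ʳ_; insert; remove; insert-remove; _≈_)
import Data.Fin.Permutation as Perm
open import Data.Fin.Properties using (_≟_)
import Data.Integer.Base as ℤ
open import Data.List.Base
  using (List; []; _∷_; [_]; map; length; foldr; allFin; cartesianProductWith)
open import Data.List.Membership.Propositional using (_∈_)
open import Data.List.Membership.Propositional.Properties
  using (∈-allFin; ∈-cartesianProductWith⁺)
open import Data.List.Properties using (length-++; length-map; length-tabulate)
open import Data.List.Relation.Unary.Any using (here)
open import Data.Nat.Base as ℕ using (ℕ; zero; suc; NonZero; _!)
import Data.Nat.Properties as ℕ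
open import Data.Product.Base using (∃; ∃-syntax; _×_; _,_)
open import Data.Rational.Base
  using (ℚ; 0ℚ; 1ℚ; _+_; _-_; _*_; _/_; _<_; _≤_; +-*-rawSemiring)
open import Data.Rational.Properties using (+-0-monoid)
open import Data.Sum.Base using (_⊎_)
open import Data.Vec.Base using (Vec; []; _∷_)
open import Function.Base using (id)
open import Relation.Binary.PropositionalEquality
  using (_≡_; refl; trans; cong; cong₂)
open import Relation.Nullary using (¬_; yes; no)

open import Algebra.Definitions.RawSemiring +-*-rawSemiring public using (_^_)

Σℚ : ∀ {n} → (Fin n → ℚ) → ℚ
Σℚ = sum +-0-monoid

fromℕ : ℕ → ℚ
fromℕ n = ℤ.+ n / 1

1/ℕ_ : (n : ℕ) → .{{NonZero n}} → ℚ
1/ℕ n = ℤ.+ 1 / n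

------------------------------------------------------------------------
-- Uniform averages over finite sample spaces, listed with multiplicity

mean : List ℚ → ℚ
mean []       = 0ℚ
mean (q ∷ qs) = foldr _+_ 0ℚ (q ∷ qs) * 1/ℕ (suc (length qs))

-- A permutation of Fin (suc n) is determined by the image j of zero and by
-- the permutation of Fin n it induces on the remaining points.

permutations : ∀ n → List (Permutation′ n)
permutations zero    = [ Perm.id ]
permutations (suc n) = cartesianProductWith (insert zero) (allFin (suc n)) (permutations n)

-- The list reaches every permutation and has n ! entries, so each permutation
-- occurs exactly once.

length-cartesianProductWith : ∀ {A B C : Set} (f : A → B → C) xs ys →
  length (cartesianProductWith f xs ys) ≡ length xs ℕ.* length ys
length-cartesianProductWith f []       ys = refl
length-cartesianProductWith f (x ∷ xs) ys = trans (length-++ (map (f x) ys))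
  (cong₂ ℕ._+_ (length-map (f x) ys) (length-cartesianProductWith f xs ys))

length-permutations : ∀ n → length (permutations n) ≡ n !
length-permutations zero    = refl
length-permutations (suc n) = trans
  (length-cartesianProductWith (insert zero) (allFin (suc n)) (permutations n))
  (cong₂ ℕ._*_ (length-tabulate {n = suc n} id) (length-permutations n))

permutations-complete : ∀ {n} (π : Permutation′ n) →
  ∃[ ρ ] ρ ∈ permutations n × ρ ≈ π
permutations-complete {zero}  π = Perm.id , here refl , λ ()
permutations-complete {suc n} π with permutations-complete (remove zero π)
... | ρ , ρ∈ , ρ≈ =
  insert zero (π ⟨$⟩ʳ zero) ρ
  , ∈-cartesianProductWith⁺ (insert zero) (∈-allFin (π ⟨$⟩ʳ zero)) ρ∈
  , λ i → trans (insert-cong i) (insert-remove zero π i)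
  where
  insert-cong : insert zero (π ⟨$⟩ʳ zero) ρ ≈ insert zero (π ⟨$⟩ʳ zero) (remove zero π)
  insert-cong i with zero ≟ i
  ... | yes _   = refl
  ... | no  0≢i = cong (punchIn (π ⟨$⟩ʳ zero)) (ρ≈ _)

-- All t-tuples of permutations: the sample space of t independent uniform ones.

histories : ∀ n t → List (Vec (Permutation′ n) t)
histories n zero    = [ [] ]
histories n (suc t) = cartesianProductWith _∷_ (permutations n) (histories n t)

------------------------------------------------------------------------
-- Buffer shuffling with M servers, each shuffling K cards per round

module BufferShuffle (K M : ℕ) .{{_ : NonZero K}} .{{_ : NonZero M}} where

  n : ℕ
  n = M ℕ.* K

  instance
    n≢0 : NonZero n
    n≢0 = ℕ.m*n≢0 M K

  Weights : Set
  Weights = Fin n → ℚ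

  initial : Weights
  initial i with toℕ i
  ... | zero  = 1ℚ
  ... | suc _ = 0ℚ

  permute : Permutation′ n → Weights → Weights
  permute σ v i = v (σ ⟨$⟩ʳ i)

  -- Block b consists of the positions combine b j, that is K * b + j, for j < K.

  averageBlocks : Weights → Weights
  averageBlocks v i = Σℚ (λ (j : Fin K) → v (combine (quotient {M} K i) j)) * 1/ℕ K

  -- The visible permutation of the latest round is the head of the history.

  w : ∀ {t} → Vec (Permutation′ n) t → Weights
  w []       = initial
  w (σ ∷ σs) = averageBlocks (permute σ (w σs))

  Φ : ∀ {t} → Vec (Permutation′ n) t → ℚ
  Φ σs = Σℚ (λ i → w σs i * w σs i) - 1/ℕ n

  𝔼Φ : ℕ → ℚ
  𝔼Φ t = mean (map Φ (histories n t))

------------------------------------------------------------------------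
-- Real numbers as two-sided Dedekind cuts

record Cut : Set₁ where
  field
    lower : ℚ → Set   -- lower q means q < x
    upper : ℚ → Set   -- upper q means x < q

open Cut public

record IsDedekind (x : Cut) : Set where
  field
    lower-inhabited : ∃ (lower x)
    upper-inhabited : ∃ (upper x)
    lower-closed    : ∀ {q r} → q < r → lower x r → lower x q
    upper-closed    : ∀ {q r} → q < r → upper x q → upper x r
    lower-open      : ∀ {q} → lower x q → ∃[ r ] q < r × lower x r
    upper-open      : ∀ {q} → upper x q → ∃[ r ] r < q × upper x r
    disjoint        : ∀ {q} → lower x q → ¬ upper x q
    located         : ∀ {q r} → q < r → lower x q ⊎ upper x r

record ℝ : Set₁ where
  field
    cut        : Cut
    isDedekind : IsDedekind cut

open ℝ public

infix 4 _≤ℚ_ _ℚ≤_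

_≤ℚ_ : Cut → ℚ → Set
x ≤ℚ q = ¬ lower x q

_ℚ≤_ : ℚ → Cut → Set
q ℚ≤ x = ¬ upper x q

-- The operations below are given by their cuts only, and they denote
-- multiplication, inversion and exponentiation for positive arguments.

infixl 7 _·_
infixr 8 _↑_

_·_ : Cut → Cut → Cut
lower (x · y) q = ∃[ r ] ∃[ s ]
  0ℚ < r × 0ℚ < s × lower x r × lower y s × q < r * s
upper (x · y) q = ∃[ r ] ∃[ s ]
  upper x r × upper y s × r * s < q

recip : Cut → Cut
lower (recip x) q = ∃[ r ] upper x r × q * r < 1ℚ
upper (recip x) q = ∃[ r ] 0ℚ < r × lower x r × 1ℚ < q * r

-- n ↑ x is the real power nˣ for n ≥ 1 and x > 0, squeezed between the
-- rational powers n^(k/m) with k/m < x and those with k/m > x; an inequality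
-- between r > 0 and n^(k/m) is one between r ^ m and n ^ k.

_↑_ : ℕ → Cut → Cut
lower (n ↑ x) q = ∃[ r ] q ≤ r × 0ℚ ≤ r × ∃[ k ] ∃[ m ]
  lower x (ℤ.+ k / suc m) × r ^ suc m < fromℕ n ^ k
upper (n ↑ x) q = 0ℚ < q × ∃[ k ] ∃[ m ]
  upper x (ℤ.+ k / suc m) × fromℕ n ^ k < q ^ suc m

-- The ceiling of a real is not computable, so it is a relation.

IsCeiling : Cut → ℕ → Set
IsCeiling x t = lower x (fromℕ t - 1ℚ) × x ≤ℚ fromℕ t

{-# OPTIONS --safe #-}

-- Centre the weights: u = w - 1/n has sum 0, evolves by the same rule as w,
-- and Φ is its sum of squares.  If S and Q are the sum and the sum of squares
-- of u, then for positions i ≠ j and a uniform permutation σ the expectation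
-- of u (σ i) * u (σ j) is a nonnegative multiple of S² - Q = - Q.  A block with
-- sum s contributes s² / K to the sum of squares after averaging; expanding s²
-- and dropping the nonpositive cross terms leaves at most Q / K in expectation.
--
-- For the second part, 1 < 𝔼Φ * r with r < n^b would give K^t < n^(k/m) for
-- some k/m < b.  But bc ≤ t forces k/(tm) < 1/c, so the hypothesis
-- n^(1/c) ≤ K yields n^k ≤ K^(tm).

module Submission where

open import Defs
open import Algebra.Bundles using (CommutativeRing)
import Algebra.Properties.CommutativeSemiring.Exp as Exp
import Algebra.Properties.Semiring.Sum as Sum
open import Data.Fin.Base using (Fin; zero; suc; _↑ˡ_; _↑ʳ_; combine; punchIn; quotient)
open import Data.Fin.Permutation using (Permutation′; _⟨$⟩ʳ_; insert)
open import Data.Fin.Properties using (suc-injective; remQuot-combine; combine-injectiveʳ)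
import Data.Integer.Base as ℤ
import Data.Integer.Properties as ℤ
open import Data.List.Base
  using (List; []; _∷_; _++_; map; foldr; length; tabulate; allFin; cartesianProductWith)
open import Data.List.Properties using (map-∘; map-id; length-map)
open import Data.Nat.Base as ℕ using (ℕ; zero; suc; NonZero)
import Data.Nat.Properties as ℕ
open import Data.Product.Base using (∃-syntax; _×_; _,_; proj₁)
open import Data.Rational.Base
  using (ℚ; 0ℚ; 1ℚ; ½; _+_; _-_; -_; _*_; _/_; 1/_; _<_; _≤_; toℚᵘ;
         positive; nonNegative; nonPositive)
open import Data.Rational.Properties
open import Data.Rational.Solver
import Data.Rational.Unnormalised.Base as ℚᵘ
import Data.Rational.Unnormalised.Properties as ℚᵘ
open import Data.Sum.Base using (inj₁; inj₂; [_,_]′)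
open import Data.Vec.Base using (Vec; []; _∷_)
open import Function.Base using (_∘_; id)
open import Relation.Binary.PropositionalEquality
  using (_≡_; _≢_; refl; sym; trans; cong; cong₂; subst; subst₂; module ≡-Reasoning)
open import Relation.Nullary using (¬_; contradiction)
open import Relation.Nullary.Decidable using (from-yes)

open +-*-Solver using (solve; con; _:=_; _:+_; _:-_; _:*_; :-_)
open Exp (CommutativeRing.commutativeSemiring +-*-commutativeRing) using (^-assocʳ; ^-distrib-*)
open Sum (CommutativeRing.semiring +-*-commutativeRing)
  using (sum-cong-≗; sum-remove; sum-permute; ∑-distrib-+; *-distribˡ-sum; *-distribʳ-sum;
         sum-replicate-zero)

-- Rational arithmetic

0≤p*q : ∀ {p q} → 0ℚ ≤ p → 0ℚ ≤ q → 0ℚ ≤ p * q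
0≤p*q {p} {q} 0≤p 0≤q = nonNegative⁻¹ (p * q)
  {{nonNeg*nonNeg⇒nonNeg p {{nonNegative 0≤p}} q {{nonNegative 0≤q}}}}

0≤p*p : ∀ p → 0ℚ ≤ p * p
0≤p*p p with ≤-total 0ℚ p
... | inj₁ 0≤p = 0≤p*q 0≤p 0≤p
... | inj₂ p≤0 = nonNegative⁻¹ (p * p)
  {{nonPos*nonPos⇒nonPos p {{nonPositive p≤0}} p {{nonPositive p≤0}}}}

0≤p^k : ∀ {p} → 0ℚ ≤ p → ∀ k → 0ℚ ≤ p ^ k
0≤p^k 0≤p zero    = nonNegative⁻¹ 1ℚ
0≤p^k 0≤p (suc k) = 0≤p*q 0≤p (0≤p^k 0≤p k)

-- Normalised fractions do not compute for variable denominators, so the identity is checked on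
-- unnormalised rationals, where it is a cross-multiplication.
/-*-fromℕ : ∀ i n .{{_ : NonZero n}} → (i / n) * fromℕ n ≡ i / 1
/-*-fromℕ i (suc n) = toℚᵘ-injective (begin
  toℚᵘ (i / suc n * fromℕ (suc n))
    ≈⟨ toℚᵘ-homo-* (i / suc n) (fromℕ (suc n)) ⟩
  toℚᵘ (i / suc n) ℚᵘ.* toℚᵘ (fromℕ (suc n))
    ≈⟨ ℚᵘ.*-cong (toℚᵘ-fromℚᵘ (ℚᵘ.mkℚᵘ i n)) (toℚᵘ-fromℚᵘ (ℚᵘ.mkℚᵘ (ℤ.+ suc n) 0)) ⟩
  ℚᵘ.mkℚᵘ i n ℚᵘ.* ℚᵘ.mkℚᵘ (ℤ.+ suc n) 0
    ≈⟨ ℚᵘ.*≡* (trans (ℤ.*-identityʳ (i ℤ.* ℤ.+ suc n))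
        (cong (λ d → i ℤ.* ℤ.+ suc d) (sym (ℕ.*-identityʳ n)))) ⟩
  ℚᵘ.mkℚᵘ i 0
    ≈⟨ toℚᵘ-fromℚᵘ (ℚᵘ.mkℚᵘ i 0) ⟨
  toℚᵘ (i / 1) ∎)
  where open ℚᵘ.≃-Reasoning

fromℕ-suc : ∀ n → fromℕ (suc n) ≡ 1ℚ + fromℕ n
fromℕ-suc n = toℚᵘ-injective (begin
  toℚᵘ (fromℕ (suc n))
    ≈⟨ toℚᵘ-fromℚᵘ (ℚᵘ.mkℚᵘ (ℤ.+ suc n) 0) ⟩
  ℚᵘ.mkℚᵘ (ℤ.+ suc n) 0
    ≈⟨ ℚᵘ.*≡* (cong (λ i → (ℤ.1ℤ ℤ.+ i) ℤ.* ℤ.1ℤ) (sym (ℤ.*-identityʳ (ℤ.+ n)))) ⟩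
  ℚᵘ.1ℚᵘ ℚᵘ.+ ℚᵘ.mkℚᵘ (ℤ.+ n) 0
    ≈⟨ ℚᵘ.+-congʳ ℚᵘ.1ℚᵘ (toℚᵘ-fromℚᵘ (ℚᵘ.mkℚᵘ (ℤ.+ n) 0)) ⟨
  ℚᵘ.1ℚᵘ ℚᵘ.+ toℚᵘ (fromℕ n)
    ≈⟨ toℚᵘ-homo-+ 1ℚ (fromℕ n) ⟨
  toℚᵘ (1ℚ + fromℕ n) ∎)
  where open ℚᵘ.≃-Reasoning

0≤fromℕ : ∀ n → 0ℚ ≤ fromℕ n
0≤fromℕ n = nonNegative⁻¹ (fromℕ n) {{normalize-nonNeg n 1}}

fromℕ-+ : ∀ m n → fromℕ (m ℕ.+ n) ≡ fromℕ m + fromℕ n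
fromℕ-+ zero    n = sym (+-identityˡ (fromℕ n))
fromℕ-+ (suc m) n = begin
  fromℕ (suc m ℕ.+ n)         ≡⟨ fromℕ-suc (m ℕ.+ n) ⟩
  1ℚ + fromℕ (m ℕ.+ n)        ≡⟨ cong (1ℚ +_) (fromℕ-+ m n) ⟩
  1ℚ + (fromℕ m + fromℕ n)    ≡⟨ +-assoc 1ℚ (fromℕ m) (fromℕ n) ⟨
  1ℚ + fromℕ m + fromℕ n      ≡⟨ cong (_+ fromℕ n) (fromℕ-suc m) ⟨
  fromℕ (suc m) + fromℕ n     ∎
  where open ≡-Reasoning

fromℕ-* : ∀ m n → fromℕ (m ℕ.* n) ≡ fromℕ m * fromℕ n
fromℕ-* zero    n = sym (*-zeroˡ (fromℕ n))
fromℕ-* (suc m) n = begin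
  fromℕ (n ℕ.+ m ℕ.* n)       ≡⟨ fromℕ-+ n (m ℕ.* n) ⟩
  fromℕ n + fromℕ (m ℕ.* n)   ≡⟨ cong (fromℕ n +_) (fromℕ-* m n) ⟩
  fromℕ n + fromℕ m * fromℕ n ≡⟨ solve 2 (λ x y → y :+ x :* y := (con 1ℚ :+ x) :* y) refl (fromℕ m) (fromℕ n) ⟩
  (1ℚ + fromℕ m) * fromℕ n    ≡⟨ cong (_* fromℕ n) (fromℕ-suc m) ⟨
  fromℕ (suc m) * fromℕ n     ∎
  where open ≡-Reasoning

0≤1/ℕ : ∀ n .{{_ : NonZero n}} → 0ℚ ≤ 1/ℕ n
0≤1/ℕ n = nonNegative⁻¹ (1/ℕ n) {{normalize-nonNeg 1 n}}

^-monoˡ-≤ : ∀ {p q} k → 0ℚ ≤ p → p ≤ q → p ^ k ≤ q ^ k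
^-monoˡ-≤         zero    0≤p p≤q = ≤-refl
^-monoˡ-≤ {p} {q} (suc k) 0≤p p≤q = begin
  p * p ^ k ≤⟨ *-monoˡ-≤-nonNeg p {{nonNegative 0≤p}} (^-monoˡ-≤ k 0≤p p≤q) ⟩
  p * q ^ k ≤⟨ *-monoʳ-≤-nonNeg (q ^ k) {{nonNegative (0≤p^k (≤-trans 0≤p p≤q) k)}} p≤q ⟩
  q * q ^ k ∎
  where open ≤-Reasoning

1^k≡1 : ∀ k → 1ℚ ^ k ≡ 1ℚ
1^k≡1 zero    = refl
1^k≡1 (suc k) = trans (*-identityˡ (1ℚ ^ k)) (1^k≡1 k)

1≤p^k : ∀ {p} → 1ℚ ≤ p → ∀ k → 1ℚ ≤ p ^ k
1≤p^k {p} 1≤p k = subst (_≤ p ^ k) (1^k≡1 k) (^-monoˡ-≤ k (nonNegative⁻¹ 1ℚ) 1≤p)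

1≤fromℕ : ∀ n .{{_ : NonZero n}} → 1ℚ ≤ fromℕ n
1≤fromℕ (suc n) = begin
  1ℚ            ≡⟨ +-identityʳ 1ℚ ⟨
  1ℚ + 0ℚ       ≤⟨ +-monoʳ-≤ 1ℚ (0≤fromℕ n) ⟩
  1ℚ + fromℕ n  ≡⟨ fromℕ-suc n ⟨
  fromℕ (suc n) ∎
  where open ≤-Reasoning

0<fromℕ : ∀ n .{{_ : NonZero n}} → 0ℚ < fromℕ n
0<fromℕ n = <-≤-trans (positive⁻¹ 1ℚ) (1≤fromℕ n)

divide : ∀ p q → 0ℚ < p → 0ℚ < q → ∃[ s ] 0ℚ < s × p * s ≡ q
divide p q 0<p 0<q = q * 1/p , positive⁻¹ (q * 1/p) {{pos*pos⇒pos q {{positive 0<q}} 1/p {{1/pos⇒pos p}}}} , (begin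
  p * (q * 1/p)  ≡⟨ solve 3 (λ p q x → p :* (q :* x) := q :* (p :* x)) refl p q 1/p ⟩
  q * (p * 1/p)  ≡⟨ cong (q *_) (*-inverseʳ p) ⟩
  q * 1ℚ         ≡⟨ *-identityʳ q ⟩
  q              ∎)
  where
  open ≡-Reasoning
  instance
    _ = positive 0<p
    _ = pos⇒nonZero p
  1/p : ℚ
  1/p = 1/ p

-- Multiplying by `suc m` turns both sides into `fromℕ k`; the positive factor is then cancelled
-- from `≤` in both directions.
/-*-numerator : ∀ k t m → (ℤ.+ k / (suc t ℕ.* suc m)) * fromℕ (suc t) ≡ ℤ.+ k / suc m
/-*-numerator k t m = ≤-antisym
  (*-cancelʳ-≤-pos (fromℕ (suc m)) (≤-reflexive scaled))
  (*-cancelʳ-≤-pos (fromℕ (suc m)) (≤-reflexive (sym scaled)))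
  where
  open ≡-Reasoning
  instance _ = positive (0<fromℕ (suc m))
  scaled : (ℤ.+ k / (suc t ℕ.* suc m)) * fromℕ (suc t) * fromℕ (suc m) ≡ (ℤ.+ k / suc m) * fromℕ (suc m)
  scaled = begin
    (ℤ.+ k / (suc t ℕ.* suc m)) * fromℕ (suc t) * fromℕ (suc m)
      ≡⟨ *-assoc (ℤ.+ k / (suc t ℕ.* suc m)) (fromℕ (suc t)) (fromℕ (suc m)) ⟩
    (ℤ.+ k / (suc t ℕ.* suc m)) * (fromℕ (suc t) * fromℕ (suc m))
      ≡⟨ cong ((ℤ.+ k / (suc t ℕ.* suc m)) *_) (fromℕ-* (suc t) (suc m)) ⟨
    (ℤ.+ k / (suc t ℕ.* suc m)) * fromℕ (suc t ℕ.* suc m)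
      ≡⟨ /-*-fromℕ (ℤ.+ k) (suc t ℕ.* suc m) ⟩
    fromℕ k
      ≡⟨ /-*-fromℕ (ℤ.+ k) (suc m) ⟨
    (ℤ.+ k / suc m) * fromℕ (suc m) ∎

-- Sums over Fin n and over lists

Σℚ-cong : ∀ {n} {f g : Fin n → ℚ} → (∀ i → f i ≡ g i) → Σℚ f ≡ Σℚ g
Σℚ-cong = sum-cong-≗

Σℚ-distrib-- : ∀ {n} (f g : Fin n → ℚ) → Σℚ (λ i → f i - g i) ≡ Σℚ f - Σℚ g
Σℚ-distrib-- {zero}  f g = refl
Σℚ-distrib-- {suc n} f g = trans
  (cong (f zero - g zero +_) (Σℚ-distrib-- (f ∘ suc) (g ∘ suc)))
  (solve 4 (λ a b c d → a :- b :+ (c :- d) := a :+ c :- (b :+ d)) refl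
    (f zero) (g zero) (Σℚ (f ∘ suc)) (Σℚ (g ∘ suc)))

Σℚ-const : ∀ n q → Σℚ {n} (λ _ → q) ≡ fromℕ n * q
Σℚ-const zero    q = sym (*-zeroˡ q)
Σℚ-const (suc n) q = begin
  q + Σℚ {n} (λ _ → q)  ≡⟨ cong (q +_) (Σℚ-const n q) ⟩
  q + fromℕ n * q       ≡⟨ solve 2 (λ x y → y :+ x :* y := (con 1ℚ :+ x) :* y) refl (fromℕ n) q ⟩
  (1ℚ + fromℕ n) * q    ≡⟨ cong (_* q) (fromℕ-suc n) ⟨
  fromℕ (suc n) * q     ∎
  where open ≡-Reasoning

Σℚ-mono-≤ : ∀ {n} {f g : Fin n → ℚ} → (∀ i → f i ≤ g i) → Σℚ f ≤ Σℚ g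
Σℚ-mono-≤ {zero}  f≤g = ≤-refl
Σℚ-mono-≤ {suc n} f≤g = +-mono-≤ (f≤g zero) (Σℚ-mono-≤ (f≤g ∘ suc))

Σℚ-0 : ∀ n → Σℚ {n} (λ _ → 0ℚ) ≡ 0ℚ
Σℚ-0 = sum-replicate-zero

0≤Σℚ : ∀ {n} {f : Fin n → ℚ} → (∀ i → 0ℚ ≤ f i) → 0ℚ ≤ Σℚ f
0≤Σℚ {n} {f} 0≤f = subst (_≤ Σℚ f) (Σℚ-0 n) (Σℚ-mono-≤ 0≤f)

Σℚ-punchIn : ∀ {n} (f : Fin (suc n) → ℚ) i → Σℚ (f ∘ punchIn i) ≡ Σℚ f - f i
Σℚ-punchIn f i = trans
  (solve 2 (λ a b → b := a :+ b :- a) refl (f i) (Σℚ (f ∘ punchIn i)))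
  (cong (_- f i) (sym (sum-remove {i = i} f)))

-- This is how the cross terms in the expansion of a squared block sum are dropped.
Σℚ-≤-diagonal : ∀ {n} (f : Fin n → ℚ) i → (∀ j → i ≢ j → f j ≤ 0ℚ) → Σℚ f ≤ f i
Σℚ-≤-diagonal {suc n} f zero off = begin
  f zero + Σℚ (f ∘ suc)      ≤⟨ +-monoʳ-≤ (f zero) (Σℚ-mono-≤ {g = λ _ → 0ℚ} (λ j → off (suc j) λ ())) ⟩
  f zero + Σℚ {n} (λ _ → 0ℚ) ≡⟨ cong (f zero +_) (Σℚ-0 n) ⟩
  f zero + 0ℚ                ≡⟨ +-identityʳ (f zero) ⟩
  f zero                     ∎
  where open ≤-Reasoning
Σℚ-≤-diagonal {suc n} f (suc i) off = begin
  f zero + Σℚ (f ∘ suc) ≤⟨ +-mono-≤ (off zero λ ())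
    (Σℚ-≤-diagonal (f ∘ suc) i (λ j i≢j → off (suc j) (i≢j ∘ suc-injective))) ⟩
  0ℚ + f (suc i)        ≡⟨ +-identityˡ (f (suc i)) ⟩
  f (suc i)             ∎
  where open ≤-Reasoning

Σℚ-↑ : ∀ m {n} (f : Fin (m ℕ.+ n) → ℚ) → Σℚ f ≡ Σℚ (λ i → f (i ↑ˡ n)) + Σℚ (λ j → f (m ↑ʳ j))
Σℚ-↑ zero    f = sym (+-identityˡ (Σℚ f))
Σℚ-↑ (suc m) f = trans (cong (f zero +_) (Σℚ-↑ m (f ∘ suc))) (sym (+-assoc (f zero) _ _))

Σℚ-combine : ∀ m {n} (f : Fin (m ℕ.* n) → ℚ) → Σℚ f ≡ Σℚ (λ i → Σℚ (λ j → f (combine {m} i j)))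
Σℚ-combine zero        f = refl
Σℚ-combine (suc m) {n} f = trans (Σℚ-↑ n f)
  (cong (Σℚ (λ i → f (i ↑ˡ (m ℕ.* n))) +_) (Σℚ-combine m (λ j → f (n ↑ʳ j))))

-- An unnormalised expectation over a listed sample space. Normalisation is postponed to `mean-≤`,
-- so the estimates in between carry the number of samples as a factor.
∑ : ∀ {A : Set} → List A → (A → ℚ) → ℚ
∑ xs f = foldr _+_ 0ℚ (map f xs)

∑-cong : ∀ {A : Set} (xs : List A) {f g : A → ℚ} → (∀ x → f x ≡ g x) → ∑ xs f ≡ ∑ xs g
∑-cong []       f≗g = refl
∑-cong (x ∷ xs) f≗g = cong₂ _+_ (f≗g x) (∑-cong xs f≗g)

∑-mono-≤ : ∀ {A : Set} (xs : List A) {f g : A → ℚ} → (∀ x → f x ≤ g x) → ∑ xs f ≤ ∑ xs g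
∑-mono-≤ []       f≤g = ≤-refl
∑-mono-≤ (x ∷ xs) f≤g = +-mono-≤ (f≤g x) (∑-mono-≤ xs f≤g)

∑-*ˡ : ∀ {A : Set} (xs : List A) q (f : A → ℚ) → ∑ xs (λ x → q * f x) ≡ q * ∑ xs f
∑-*ˡ []       q f = sym (*-zeroʳ q)
∑-*ˡ (x ∷ xs) q f = trans (cong (q * f x +_) (∑-*ˡ xs q f)) (sym (*-distribˡ-+ q (f x) (∑ xs f)))

∑-const : ∀ {A : Set} (xs : List A) q → ∑ xs (λ _ → q) ≡ fromℕ (length xs) * q
∑-const []       q = sym (*-zeroˡ q)
∑-const (x ∷ xs) q = begin
  q + ∑ xs (λ _ → q)              ≡⟨ cong (q +_) (∑-const xs q) ⟩
  q + fromℕ (length xs) * q       ≡⟨ solve 2 (λ x y → y :+ x :* y := (con 1ℚ :+ x) :* y) refl (fromℕ (length xs)) q ⟩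
  (1ℚ + fromℕ (length xs)) * q    ≡⟨ cong (_* q) (fromℕ-suc (length xs)) ⟨
  fromℕ (suc (length xs)) * q     ∎
  where open ≡-Reasoning

∑-++ : ∀ {A : Set} (xs ys : List A) (f : A → ℚ) → ∑ (xs ++ ys) f ≡ ∑ xs f + ∑ ys f
∑-++ []       ys f = sym (+-identityˡ (∑ ys f))
∑-++ (x ∷ xs) ys f = trans (cong (f x +_) (∑-++ xs ys f)) (sym (+-assoc (f x) (∑ xs f) (∑ ys f)))

∑-Σℚ : ∀ {A : Set} {n} (xs : List A) (f : A → Fin n → ℚ) →
  ∑ xs (λ x → Σℚ (f x)) ≡ Σℚ (λ i → ∑ xs (λ x → f x i))
∑-Σℚ {n = n} []       f = sym (Σℚ-0 n)
∑-Σℚ         (x ∷ xs) f = trans (cong (Σℚ (f x) +_) (∑-Σℚ xs f))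
  (sym (∑-distrib-+ (f x) (λ i → ∑ xs (λ y → f y i))))

∑-cartesianProductWith : ∀ {A B C : Set} (g : A → B → C) xs ys (f : C → ℚ) →
  ∑ (cartesianProductWith g xs ys) f ≡ ∑ xs (λ x → ∑ ys (λ y → f (g x y)))
∑-cartesianProductWith g []       ys f = refl
∑-cartesianProductWith g (x ∷ xs) ys f = trans
  (∑-++ (map (g x) ys) (cartesianProductWith g xs ys) f)
  (cong₂ _+_ (cong (foldr _+_ 0ℚ) (sym (map-∘ ys))) (∑-cartesianProductWith g xs ys f))

∑-swap : ∀ {A B : Set} (xs : List A) (ys : List B) (f : A → B → ℚ) →
  ∑ xs (λ x → ∑ ys (f x)) ≡ ∑ ys (λ y → ∑ xs (λ x → f x y))
∑-swap xs []       f = trans (∑-const xs 0ℚ) (*-zeroʳ (fromℕ (length xs)))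
∑-swap xs (y ∷ ys) f = trans (split xs) (cong (∑ xs (λ x → f x y) +_) (∑-swap xs ys f))
  where
  split : ∀ zs → ∑ zs (λ x → f x y + ∑ ys (f x)) ≡ ∑ zs (λ x → f x y) + ∑ zs (λ x → ∑ ys (f x))
  split []       = refl
  split (z ∷ zs) = trans (cong (f z y + ∑ ys (f z) +_) (split zs))
    (solve 4 (λ a b c d → a :+ b :+ (c :+ d) := a :+ c :+ (b :+ d)) refl
      (f z y) (∑ ys (f z)) (∑ zs (λ x → f x y)) (∑ zs (λ x → ∑ ys (f x))))

∑-tabulate : ∀ {A : Set} {n} (g : Fin n → A) (f : A → ℚ) → ∑ (tabulate g) f ≡ Σℚ (f ∘ g)
∑-tabulate {n = zero}  g f = refl
∑-tabulate {n = suc n} g f = cong (f (g zero) +_) (∑-tabulate (g ∘ suc) f)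

-- The condition `0ℚ ≤ q` settles the empty list, whose mean is 0 by convention, so no sample space
-- has to be shown inhabited.
mean-≤ : ∀ qs {q} → 0ℚ ≤ q → ∑ qs id ≤ q * fromℕ (length qs) → mean qs ≤ q
mean-≤ []       0≤q _ = 0≤q
mean-≤ (p ∷ ps) {q} 0≤q ∑≤ = begin
  foldr _+_ 0ℚ (p ∷ ps) * 1/ℕ l  ≡⟨ cong (λ xs → foldr _+_ 0ℚ xs * 1/ℕ l) (map-id (p ∷ ps)) ⟨
  ∑ (p ∷ ps) id * 1/ℕ l          ≤⟨ *-monoʳ-≤-nonNeg (1/ℕ l) {{normalize-nonNeg 1 l}} ∑≤ ⟩
  q * fromℕ l * 1/ℕ l            ≡⟨ solve 3 (λ a b c → a :* b :* c := a :* (c :* b)) refl q (fromℕ l) (1/ℕ l) ⟩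
  q * (1/ℕ l * fromℕ l)          ≡⟨ cong (q *_) (/-*-fromℕ ℤ.1ℤ l) ⟩
  q * 1ℚ                         ≡⟨ *-identityʳ q ⟩
  q                              ∎
  where
  open ≤-Reasoning
  l : ℕ
  l = suc (length ps)

-- Averages over random permutations

-- Conditioning on the image `x` of zero: the rest of the permutation is uniform onto the points
-- other than `x`. The inductions on positions below rest on this split.
∑-permutations : ∀ n (f : Permutation′ (suc n) → ℚ) →
  ∑ (permutations (suc n)) f ≡ Σℚ (λ x → ∑ (permutations n) (λ σ → f (insert zero x σ)))
∑-permutations n f = trans
  (∑-cartesianProductWith (insert zero) (allFin (suc n)) (permutations n) f)
  (∑-tabulate {n = suc n} id (λ x → ∑ (permutations n) (λ σ → f (insert zero x σ))))

-- The constants are (n - 1)! here and (n - 2)! below; only their signs matter.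

∑-marginal : ∀ {n} (i : Fin n) → ∃[ d ] 0ℚ ≤ d × ∀ (u : Fin n → ℚ) →
  ∑ (permutations n) (λ σ → u (σ ⟨$⟩ʳ i)) ≡ d * Σℚ u
∑-marginal {suc n} zero = fromℕ (length (permutations n)) , 0≤fromℕ (length (permutations n)) , λ u → begin
  ∑ (permutations (suc n)) (λ σ → u (σ ⟨$⟩ʳ zero))            ≡⟨ ∑-permutations n _ ⟩
  Σℚ (λ x → ∑ (permutations n) (λ _ → u x))                  ≡⟨ Σℚ-cong (λ x → ∑-const (permutations n) (u x)) ⟩
  Σℚ (λ x → fromℕ (length (permutations n)) * u x)           ≡⟨ *-distribˡ-sum (fromℕ (length (permutations n))) u ⟨
  fromℕ (length (permutations n)) * Σℚ u                     ∎
  where open ≡-Reasoning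
∑-marginal {suc n} (suc i) = let (d , 0≤d , marginal) = ∑-marginal i in
  d * fromℕ n , 0≤p*q 0≤d (0≤fromℕ n) , λ u → begin
  ∑ (permutations (suc n)) (λ σ → u (σ ⟨$⟩ʳ suc i))            ≡⟨ ∑-permutations n _ ⟩
  Σℚ (λ x → ∑ (permutations n) (λ σ → u (punchIn x (σ ⟨$⟩ʳ i)))) ≡⟨ Σℚ-cong (λ x → marginal (u ∘ punchIn x)) ⟩
  Σℚ (λ x → d * Σℚ (u ∘ punchIn x))                          ≡⟨ *-distribˡ-sum d (λ x → Σℚ (u ∘ punchIn x)) ⟨
  -- Each of the n + 1 values `x` is left out once, so the punctured sums add up to (n + 1) S - S =
  -- n S.
  d * Σℚ (λ x → Σℚ (u ∘ punchIn x))                          ≡⟨ cong (d *_) (Σℚ-cong (Σℚ-punchIn u)) ⟩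
  d * Σℚ (λ x → Σℚ u - u x)                                  ≡⟨ cong (d *_) (Σℚ-distrib-- (λ _ → Σℚ u) u) ⟩
  d * (Σℚ {suc n} (λ _ → Σℚ u) - Σℚ u)                       ≡⟨ cong (λ q → d * (Σℚ u + q - Σℚ u)) (Σℚ-const n (Σℚ u)) ⟩
  d * (Σℚ u + fromℕ n * Σℚ u - Σℚ u)                         ≡⟨ solve 3 (λ d s n → d :* (s :+ n :* s :- s) := d :* n :* s) refl d (Σℚ u) (fromℕ n) ⟩
  d * fromℕ n * Σℚ u                                         ∎
  where open ≡-Reasoning

-- Leaving out the entry `u x` changes the sum s to s - u x and the sum of squares q to q - (u x)².
-- The left side therefore adds up the factor S² - Q of all punctured vectors, as the induction in
-- `∑-correlation` requires.
Σℚ-punctured : ∀ {n} c s q (u : Fin n → ℚ) →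
  Σℚ (λ x → c * ((s - u x) * (s - u x) - (q - u x * u x))) ≡
  c * (fromℕ n * (s * s - q) - (1ℚ + 1ℚ) * (s * Σℚ u - Σℚ (λ x → u x * u x)))
Σℚ-punctured {n} c s q u = begin
  Σℚ (λ x → c * ((s - u x) * (s - u x) - (q - u x * u x)))
    ≡⟨ Σℚ-cong (λ x → expand (u x)) ⟩
  Σℚ (λ x → c * (s * s - q - (1ℚ + 1ℚ) * (s * u x - u x * u x)))
    ≡⟨ *-distribˡ-sum c (λ x → s * s - q - (1ℚ + 1ℚ) * (s * u x - u x * u x)) ⟨
  c * Σℚ (λ x → s * s - q - (1ℚ + 1ℚ) * (s * u x - u x * u x))
    ≡⟨ cong (c *_) (Σℚ-distrib-- (λ _ → s * s - q) (λ x → (1ℚ + 1ℚ) * (s * u x - u x * u x))) ⟩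
  c * (Σℚ {n} (λ _ → s * s - q) - Σℚ (λ x → (1ℚ + 1ℚ) * (s * u x - u x * u x)))
    ≡⟨ cong₂ (λ a b → c * (a - b)) (Σℚ-const n (s * s - q))
        (trans (sym (*-distribˡ-sum (1ℚ + 1ℚ) (λ x → s * u x - u x * u x)))
          (cong ((1ℚ + 1ℚ) *_) (trans (Σℚ-distrib-- (λ x → s * u x) (λ x → u x * u x))
            (cong (_- Σℚ (λ x → u x * u x)) (sym (*-distribˡ-sum s u)))))) ⟩
  c * (fromℕ n * (s * s - q) - (1ℚ + 1ℚ) * (s * Σℚ u - Σℚ (λ x → u x * u x))) ∎
  where
  open ≡-Reasoning
  expand : ∀ a → c * ((s - a) * (s - a) - (q - a * a)) ≡ c * (s * s - q - (1ℚ + 1ℚ) * (s * a - a * a))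
  expand = solve 4 (λ c s q a →
    c :* ((s :- a) :* (s :- a) :- (q :- a :* a))
    := c :* (s :* s :- q :- (con 1ℚ :+ con 1ℚ) :* (s :* a :- a :* a))) refl c s q

-- S² - Q is the sum of `u x * u y` over ordered pairs x ≠ y, and a uniform permutation sends (i, j)
-- to each such pair equally often. The proof conditions on the image of zero: if zero is one of the
-- positions, the other has a uniform marginal on the remaining points; otherwise the induction
-- hypothesis applies to the punctured vector.
∑-correlation : ∀ {n} (i j : Fin n) → i ≢ j → ∃[ c ] 0ℚ ≤ c × ∀ (u : Fin n → ℚ) →
  ∑ (permutations n) (λ σ → u (σ ⟨$⟩ʳ i) * u (σ ⟨$⟩ʳ j)) ≡ c * (Σℚ u * Σℚ u - Σℚ (λ x → u x * u x))
∑-correlation zero zero i≢j = contradiction refl i≢j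
∑-correlation {suc n} zero (suc j) _ = let (d , 0≤d , marginal) = ∑-marginal j in
  d , 0≤d , λ u → begin
  ∑ (permutations (suc n)) (λ σ → u (σ ⟨$⟩ʳ zero) * u (σ ⟨$⟩ʳ suc j))
    ≡⟨ ∑-permutations n _ ⟩
  Σℚ (λ x → ∑ (permutations n) (λ σ → u x * u (punchIn x (σ ⟨$⟩ʳ j))))
    ≡⟨ Σℚ-cong (λ x → trans (∑-*ˡ (permutations n) (u x) _)
        (cong (u x *_) (trans (marginal (u ∘ punchIn x)) (cong (d *_) (Σℚ-punchIn u x))))) ⟩
  Σℚ (λ x → u x * (d * (Σℚ u - u x)))
    ≡⟨ Σℚ-cong (λ x → solve 3 (λ a d s → a :* (d :* (s :- a)) := d :* (s :* a :- a :* a)) refl (u x) d (Σℚ u)) ⟩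
  Σℚ (λ x → d * (Σℚ u * u x - u x * u x))
    ≡⟨ *-distribˡ-sum d (λ x → Σℚ u * u x - u x * u x) ⟨
  d * Σℚ (λ x → Σℚ u * u x - u x * u x)
    ≡⟨ cong (d *_) (Σℚ-distrib-- (λ x → Σℚ u * u x) (λ x → u x * u x)) ⟩
  d * (Σℚ (λ x → Σℚ u * u x) - Σℚ (λ x → u x * u x))
    ≡⟨ cong (λ q → d * (q - Σℚ (λ x → u x * u x))) (*-distribˡ-sum (Σℚ u) u) ⟨
  d * (Σℚ u * Σℚ u - Σℚ (λ x → u x * u x)) ∎
  where open ≡-Reasoning
∑-correlation {suc n} (suc i) zero _ = let (c , 0≤c , correlation) = ∑-correlation zero (suc i) (λ ()) in
  c , 0≤c , λ u → trans
  (∑-cong (permutations (suc n)) (λ σ → *-comm (u (σ ⟨$⟩ʳ suc i)) (u (σ ⟨$⟩ʳ zero)))) (correlation u)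
∑-correlation {suc (suc n)} (suc i) (suc j) i≢j = let (c , 0≤c , correlation) = ∑-correlation i j (i≢j ∘ cong suc) in
  c * fromℕ n , 0≤p*q 0≤c (0≤fromℕ n) , λ u → begin
  ∑ (permutations (2 ℕ.+ n)) (λ σ → u (σ ⟨$⟩ʳ suc i) * u (σ ⟨$⟩ʳ suc j))
    ≡⟨ ∑-permutations (suc n) (λ σ → u (σ ⟨$⟩ʳ suc i) * u (σ ⟨$⟩ʳ suc j)) ⟩
  Σℚ (λ x → ∑ (permutations (suc n)) (λ σ → u (punchIn x (σ ⟨$⟩ʳ i)) * u (punchIn x (σ ⟨$⟩ʳ j))))
    ≡⟨ Σℚ-cong (λ x → trans (correlation (u ∘ punchIn x))
        (cong₂ (λ s q → c * (s * s - q)) (Σℚ-punchIn u x) (Σℚ-punchIn (λ y → u y * u y) x))) ⟩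
  Σℚ (λ x → c * ((Σℚ u - u x) * (Σℚ u - u x) - (Σℚ (λ y → u y * u y) - u x * u x)))
    ≡⟨ Σℚ-punctured c (Σℚ u) (Σℚ (λ y → u y * u y)) u ⟩
  c * (fromℕ (2 ℕ.+ n) * (Σℚ u * Σℚ u - Σℚ (λ y → u y * u y)) - (1ℚ + 1ℚ) * (Σℚ u * Σℚ u - Σℚ (λ y → u y * u y)))
    -- The n + 2 choices of `x` contribute the factor n + 2, and the correction for the left-out
    -- entries takes away 2.
    ≡⟨ collect c (Σℚ u * Σℚ u - Σℚ (λ y → u y * u y)) ⟩
  c * fromℕ n * (Σℚ u * Σℚ u - Σℚ (λ y → u y * u y)) ∎
  where
  open ≡-Reasoning
  collect : ∀ c d → c * (fromℕ (2 ℕ.+ n) * d - (1ℚ + 1ℚ) * d) ≡ c * fromℕ n * d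
  collect c d = trans
    (cong (λ m → c * (m * d - (1ℚ + 1ℚ) * d)) (trans (fromℕ-suc (suc n)) (cong (1ℚ +_) (fromℕ-suc n))))
    (solve 3 (λ c n d → c :* ((con 1ℚ :+ (con 1ℚ :+ n)) :* d :- (con 1ℚ :+ con 1ℚ) :* d) := c :* n :* d) refl
      c (fromℕ n) d)

-- The negative correlation of sampling without replacement: with S = 0 the factor S² - Q is minus a
-- sum of squares.
∑-correlation-≤0 : ∀ {n} (u : Fin n → ℚ) → Σℚ u ≡ 0ℚ → ∀ i j → i ≢ j →
  ∑ (permutations n) (λ σ → u (σ ⟨$⟩ʳ i) * u (σ ⟨$⟩ʳ j)) ≤ 0ℚ
∑-correlation-≤0 {n} u Σu≡0 i j i≢j = let (c , 0≤c , correlation) = ∑-correlation i j i≢j in begin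
  ∑ (permutations n) (λ σ → u (σ ⟨$⟩ʳ i) * u (σ ⟨$⟩ʳ j))     ≡⟨ correlation u ⟩
  c * (Σℚ u * Σℚ u - Q)                                     ≡⟨ cong (λ s → c * (s * s - Q)) Σu≡0 ⟩
  c * (0ℚ * 0ℚ - Q)                                         ≡⟨ solve 2 (λ c q → c :* (con 0ℚ :* con 0ℚ :- q) := :- (c :* q)) refl c Q ⟩
  - (c * Q)                                                 ≤⟨ neg-antimono-≤ (0≤p*q 0≤c (0≤Σℚ (λ x → 0≤p*p (u x)))) ⟩
  0ℚ                                                        ∎
  where
  open ≤-Reasoning
  Q : ℚ
  Q = Σℚ (λ x → u x * u x)

-- The mixnet

-- Matching both parameters as successors makes `n` a successor, so that `initial` computes to 1 at
-- the first position and 0 at all others.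
Σℚ-initial : ∀ K M .{{_ : NonZero K}} .{{_ : NonZero M}} → Σℚ (BufferShuffle.initial K M) ≡ 1ℚ
Σℚ-initial (suc K) (suc M) = trans (cong (1ℚ +_) (Σℚ-0 (K ℕ.+ M ℕ.* suc K))) (+-identityʳ 1ℚ)

energy-initial : ∀ K M .{{_ : NonZero K}} .{{_ : NonZero M}} →
  Σℚ (λ i → BufferShuffle.initial K M i * BufferShuffle.initial K M i) ≡ 1ℚ
energy-initial (suc K) (suc M) = trans (cong (1ℚ +_) (Σℚ-0 (K ℕ.+ M ℕ.* suc K))) (+-identityʳ 1ℚ)

module _ (K M : ℕ) .{{_ : NonZero K}} .{{_ : NonZero M}} where
  open BufferShuffle K M

  -- One round on a vector of sum zero

  energy : Weights → ℚ
  energy v = Σℚ (λ i → v i * v i)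

  blockSum : Weights → Fin M → ℚ
  blockSum v b = Σℚ (λ (j : Fin K) → v (combine b j))

  averageBlocks-combine : ∀ v b j → averageBlocks v (combine b j) ≡ blockSum v b * 1/ℕ K
  averageBlocks-combine v b j = cong (λ b → blockSum v b * 1/ℕ K) (cong proj₁ (remQuot-combine b j))

  Σℚ-averageBlocks : ∀ v → Σℚ (averageBlocks v) ≡ Σℚ v
  Σℚ-averageBlocks v = begin
    Σℚ (averageBlocks v)                                  ≡⟨ Σℚ-combine M (averageBlocks v) ⟩
    Σℚ (λ b → Σℚ (λ j → averageBlocks v (combine {M} b j)))   ≡⟨ Σℚ-cong (λ b → Σℚ-cong (averageBlocks-combine v b)) ⟩
    Σℚ (λ b → Σℚ {K} (λ _ → blockSum v b * 1/ℕ K))        ≡⟨ Σℚ-cong (λ b → Σℚ-const K (blockSum v b * 1/ℕ K)) ⟩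
    Σℚ (λ b → fromℕ K * (blockSum v b * 1/ℕ K))           ≡⟨ Σℚ-cong (λ b → solve 3 (λ k s x → k :* (s :* x) := x :* k :* s) refl (fromℕ K) (blockSum v b) (1/ℕ K)) ⟩
    Σℚ (λ b → 1/ℕ K * fromℕ K * blockSum v b)             ≡⟨ Σℚ-cong (λ b → cong (_* blockSum v b) (/-*-fromℕ ℤ.1ℤ K)) ⟩
    Σℚ (λ b → 1ℚ * blockSum v b)                          ≡⟨ Σℚ-cong (λ b → *-identityˡ (blockSum v b)) ⟩
    Σℚ (blockSum v)                                       ≡⟨ Σℚ-combine M v ⟨
    Σℚ v                                                  ∎
    where open ≡-Reasoning

  energy-averageBlocks : ∀ v → energy (averageBlocks v) ≡ 1/ℕ K * Σℚ (λ b → blockSum v b * blockSum v b)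
  energy-averageBlocks v = begin
    energy (averageBlocks v)
      ≡⟨ Σℚ-combine M (λ i → averageBlocks v i * averageBlocks v i) ⟩
    Σℚ (λ b → Σℚ (λ j → averageBlocks v (combine {M} b j) * averageBlocks v (combine {M} b j)))
      ≡⟨ Σℚ-cong (λ b → Σℚ-cong (λ j → cong (λ q → q * q) (averageBlocks-combine v b j))) ⟩
    Σℚ (λ b → Σℚ {K} (λ _ → blockSum v b * 1/ℕ K * (blockSum v b * 1/ℕ K)))
      ≡⟨ Σℚ-cong (λ b → Σℚ-const K (blockSum v b * 1/ℕ K * (blockSum v b * 1/ℕ K))) ⟩
    Σℚ (λ b → fromℕ K * (blockSum v b * 1/ℕ K * (blockSum v b * 1/ℕ K)))
      ≡⟨ Σℚ-cong (λ b → solve 3 (λ k s x → k :* (s :* x :* (s :* x)) := x :* k :* (x :* (s :* s))) refl (fromℕ K) (blockSum v b) (1/ℕ K)) ⟩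
    Σℚ (λ b → 1/ℕ K * fromℕ K * (1/ℕ K * (blockSum v b * blockSum v b)))
      ≡⟨ Σℚ-cong (λ b → cong (_* (1/ℕ K * (blockSum v b * blockSum v b))) (/-*-fromℕ ℤ.1ℤ K)) ⟩
    Σℚ (λ b → 1ℚ * (1/ℕ K * (blockSum v b * blockSum v b)))
      ≡⟨ Σℚ-cong (λ b → *-identityˡ (1/ℕ K * (blockSum v b * blockSum v b))) ⟩
    Σℚ (λ b → 1/ℕ K * (blockSum v b * blockSum v b))
      ≡⟨ *-distribˡ-sum (1/ℕ K) (λ b → blockSum v b * blockSum v b) ⟨
    1/ℕ K * Σℚ (λ b → blockSum v b * blockSum v b) ∎
    where open ≡-Reasoning

  blockSum-square : ∀ v b → blockSum v b * blockSum v b ≡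
    Σℚ (λ (i : Fin K) → Σℚ (λ (j : Fin K) → v (combine b i) * v (combine b j)))
  blockSum-square v b = trans (*-distribʳ-sum (blockSum v b) (λ i → v (combine b i)))
    (Σℚ-cong (λ i → *-distribˡ-sum (v (combine b i)) (λ j → v (combine b j))))

  ∑-blockSum-square : ∀ v → Σℚ v ≡ 0ℚ → ∀ b →
    ∑ (permutations n) (λ σ → blockSum (permute σ v) b * blockSum (permute σ v) b) ≤
    ∑ (permutations n) (λ σ → Σℚ (λ (i : Fin K) → permute σ v (combine b i) * permute σ v (combine b i)))
  ∑-blockSum-square v Σv≡0 b = begin
    ∑ P (λ σ → blockSum (permute σ v) b * blockSum (permute σ v) b)
      ≡⟨ ∑-cong P (λ σ → blockSum-square (permute σ v) b) ⟩
    ∑ P (λ σ → Σℚ (λ i → Σℚ (λ j → x σ i * x σ j)))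
      ≡⟨ ∑-Σℚ P (λ σ i → Σℚ (λ j → x σ i * x σ j)) ⟩
    Σℚ (λ i → ∑ P (λ σ → Σℚ (λ j → x σ i * x σ j)))
      ≡⟨ Σℚ-cong (λ i → ∑-Σℚ P (λ σ j → x σ i * x σ j)) ⟩
    Σℚ (λ i → Σℚ (λ j → ∑ P (λ σ → x σ i * x σ j)))
      -- For each offset i only the term j = i survives: different offsets in one block are
      -- different positions, so their correlation is nonpositive.
      ≤⟨ Σℚ-mono-≤ (λ i → Σℚ-≤-diagonal (λ j → ∑ P (λ σ → x σ i * x σ j)) i
          (λ j i≢j → ∑-correlation-≤0 v Σv≡0 (combine b i) (combine b j)
            (i≢j ∘ combine-injectiveʳ b i b j))) ⟩
    Σℚ (λ i → ∑ P (λ σ → x σ i * x σ i))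
      ≡⟨ ∑-Σℚ P (λ σ i → x σ i * x σ i) ⟨
    ∑ P (λ σ → Σℚ (λ i → x σ i * x σ i)) ∎
    where
    open ≤-Reasoning
    P : List (Permutation′ n)
    P = permutations n
    x : Permutation′ n → Fin K → ℚ
    x σ j = permute σ v (combine b j)

  energy-permute : ∀ σ v → energy (permute σ v) ≡ energy v
  energy-permute σ v = sym (sum-permute (λ i → v i * v i) σ)

  ∑-energy-round : ∀ v → Σℚ v ≡ 0ℚ →
    ∑ (permutations n) (λ σ → energy (averageBlocks (permute σ v))) ≤
    1/ℕ K * (fromℕ (length (permutations n)) * energy v)
  ∑-energy-round v Σv≡0 = begin
    ∑ P (λ σ → energy (averageBlocks (permute σ v)))
      ≡⟨ ∑-cong P (λ σ → energy-averageBlocks (permute σ v)) ⟩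
    ∑ P (λ σ → 1/ℕ K * Σℚ (λ b → s σ b * s σ b))
      ≡⟨ ∑-*ˡ P (1/ℕ K) (λ σ → Σℚ (λ b → s σ b * s σ b)) ⟩
    1/ℕ K * ∑ P (λ σ → Σℚ (λ b → s σ b * s σ b))
      ≡⟨ cong (1/ℕ K *_) (∑-Σℚ P (λ σ b → s σ b * s σ b)) ⟩
    1/ℕ K * Σℚ (λ b → ∑ P (λ σ → s σ b * s σ b))
      ≤⟨ *-monoˡ-≤-nonNeg (1/ℕ K) {{normalize-nonNeg 1 K}} (Σℚ-mono-≤ (∑-blockSum-square v Σv≡0)) ⟩
    1/ℕ K * Σℚ (λ b → ∑ P (λ σ → q σ b))
      ≡⟨ cong (1/ℕ K *_) (∑-Σℚ P q) ⟨
    1/ℕ K * ∑ P (λ σ → Σℚ (q σ))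
      -- The diagonal terms of all blocks together contain every square once, and permuting the
      -- entries does not change their total.
      ≡⟨ cong (1/ℕ K *_) (∑-cong P (λ σ → trans (sym (Σℚ-combine M (λ i → permute σ v i * permute σ v i))) (energy-permute σ v))) ⟩
    1/ℕ K * ∑ P (λ _ → energy v)
      ≡⟨ cong (1/ℕ K *_) (∑-const P (energy v)) ⟩
    1/ℕ K * (fromℕ (length P) * energy v) ∎
    where
    open ≤-Reasoning
    P : List (Permutation′ n)
    P = permutations n
    s : Permutation′ n → Fin M → ℚ
    s σ = blockSum (permute σ v)
    q : Permutation′ n → Fin M → ℚ
    q σ b = Σℚ (λ (i : Fin K) → permute σ v (combine b i) * permute σ v (combine b i))

  -- Centring the weights

  centred : Weights → Weights
  centred v i = v i - 1/ℕ n

  n*1/n : fromℕ n * 1/ℕ n ≡ 1ℚ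
  n*1/n = trans (*-comm (fromℕ n) (1/ℕ n)) (/-*-fromℕ ℤ.1ℤ n)

  Σℚ-centred : ∀ v → Σℚ v ≡ 1ℚ → Σℚ (centred v) ≡ 0ℚ
  Σℚ-centred v Σv≡1 = trans (Σℚ-distrib-- v (λ _ → 1/ℕ n))
    (cong₂ _-_ Σv≡1 (trans (Σℚ-const n (1/ℕ n)) n*1/n))

  energy-centred : ∀ v → Σℚ v ≡ 1ℚ → energy (centred v) ≡ energy v - 1/ℕ n
  energy-centred v Σv≡1 = begin
    energy (centred v)
      -- With x = 1/n the subtracted part is split as x a + x (a - x): the first half sums to x, the
      -- second to zero because the centred entries do.
      ≡⟨ Σℚ-cong (λ i → solve 2 (λ a x → (a :- x) :* (a :- x) := a :* a :- (x :* a :+ x :* (a :- x))) refl (v i) (1/ℕ n)) ⟩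
    Σℚ (λ i → v i * v i - (1/ℕ n * v i + 1/ℕ n * centred v i))
      ≡⟨ Σℚ-distrib-- (λ i → v i * v i) (λ i → 1/ℕ n * v i + 1/ℕ n * centred v i) ⟩
    energy v - Σℚ (λ i → 1/ℕ n * v i + 1/ℕ n * centred v i)
      ≡⟨ cong (λ q → energy v - q) (∑-distrib-+ (λ i → 1/ℕ n * v i) (λ i → 1/ℕ n * centred v i)) ⟩
    energy v - (Σℚ (λ i → 1/ℕ n * v i) + Σℚ (λ i → 1/ℕ n * centred v i))
      ≡⟨ cong₂ (λ p q → energy v - (p + q)) (*-distribˡ-sum (1/ℕ n) v) (*-distribˡ-sum (1/ℕ n) (centred v)) ⟨
    energy v - (1/ℕ n * Σℚ v + 1/ℕ n * Σℚ (centred v))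
      ≡⟨ cong₂ (λ p q → energy v - (1/ℕ n * p + 1/ℕ n * q)) Σv≡1 (Σℚ-centred v Σv≡1) ⟩
    energy v - (1/ℕ n * 1ℚ + 1/ℕ n * 0ℚ)
      ≡⟨ solve 2 (λ e x → e :- (x :* con 1ℚ :+ x :* con 0ℚ) := e :- x) refl (energy v) (1/ℕ n) ⟩
    energy v - 1/ℕ n ∎
    where open ≡-Reasoning

  -- Block averaging is linear and fixes constants. Since centring commutes with `permute` by
  -- computation, the centred weights follow the same recursion as `w`.
  averageBlocks-centred : ∀ v i → centred (averageBlocks v) i ≡ averageBlocks (centred v) i
  averageBlocks-centred v i = sym (begin
    Σℚ (λ j → y j - 1/ℕ n) * 1/ℕ K
      ≡⟨ cong (_* 1/ℕ K) (Σℚ-distrib-- y (λ _ → 1/ℕ n)) ⟩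
    (Σℚ y - Σℚ {K} (λ _ → 1/ℕ n)) * 1/ℕ K
      ≡⟨ cong (λ q → (Σℚ y - q) * 1/ℕ K) (Σℚ-const K (1/ℕ n)) ⟩
    (Σℚ y - fromℕ K * 1/ℕ n) * 1/ℕ K
      ≡⟨ solve 4 (λ s k x z → (s :- k :* x) :* z := s :* z :- z :* k :* x) refl (Σℚ y) (fromℕ K) (1/ℕ n) (1/ℕ K) ⟩
    Σℚ y * 1/ℕ K - 1/ℕ K * fromℕ K * 1/ℕ n
      ≡⟨ cong (λ q → Σℚ y * 1/ℕ K - q * 1/ℕ n) (/-*-fromℕ ℤ.1ℤ K) ⟩
    Σℚ y * 1/ℕ K - 1ℚ * 1/ℕ n
      ≡⟨ cong (λ q → Σℚ y * 1/ℕ K - q) (*-identityˡ (1/ℕ n)) ⟩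
    Σℚ y * 1/ℕ K - 1/ℕ n ∎)
    where
    open ≡-Reasoning
    y : Fin K → ℚ
    y j = v (combine (quotient {M} K i) j)

  -- Iteration over the rounds

  Σℚ-w : ∀ {t} (σs : Vec (Permutation′ n) t) → Σℚ (w σs) ≡ 1ℚ
  Σℚ-w []       = Σℚ-initial K M
  Σℚ-w (σ ∷ σs) = trans (Σℚ-averageBlocks (permute σ (w σs)))
    (trans (sym (sum-permute (w σs) σ)) (Σℚ-w σs))

  Φ≡energy : ∀ {t} (σs : Vec (Permutation′ n) t) → energy (centred (w σs)) ≡ Φ σs
  Φ≡energy σs = energy-centred (w σs) (Σℚ-w σs)

  Φ-initial-≤1 : Φ [] ≤ 1ℚ
  Φ-initial-≤1 = begin
    energy initial - 1/ℕ n  ≡⟨ cong (_- 1/ℕ n) (energy-initial K M) ⟩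
    1ℚ - 1/ℕ n              ≤⟨ +-monoʳ-≤ 1ℚ (neg-antimono-≤ (0≤1/ℕ n)) ⟩
    1ℚ                      ∎
    where open ≤-Reasoning

  -- The contraction conditional on the past: with `σs` fixed, `w σs` is a fixed vector and only the
  -- latest permutation is random.
  ∑-Φ-round : ∀ {t} (σs : Vec (Permutation′ n) t) →
    ∑ (permutations n) (λ σ → Φ (σ ∷ σs)) ≤ 1/ℕ K * (fromℕ (length (permutations n)) * Φ σs)
  ∑-Φ-round σs = begin
    ∑ (permutations n) (λ σ → Φ (σ ∷ σs))
      ≡⟨ ∑-cong (permutations n) (λ σ → Φ≡energy (σ ∷ σs)) ⟨
    ∑ (permutations n) (λ σ → energy (centred (w (σ ∷ σs))))
      ≡⟨ ∑-cong (permutations n) (λ σ → Σℚ-cong (λ i →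
          cong (λ q → q * q) (averageBlocks-centred (permute σ (w σs)) i))) ⟩
    ∑ (permutations n) (λ σ → energy (averageBlocks (permute σ (centred (w σs)))))
      ≤⟨ ∑-energy-round (centred (w σs)) (Σℚ-centred (w σs) (Σℚ-w σs)) ⟩
    1/ℕ K * (fromℕ (length (permutations n)) * energy (centred (w σs)))
      ≡⟨ cong (λ q → 1/ℕ K * (fromℕ (length (permutations n)) * q)) (Φ≡energy σs) ⟩
    1/ℕ K * (fromℕ (length (permutations n)) * Φ σs) ∎
    where open ≤-Reasoning

  ∑-Φ : ∀ t → ∑ (histories n t) Φ ≤ (1/ℕ K) ^ t * fromℕ (length (histories n t))
  ∑-Φ zero    = begin
    Φ [] + 0ℚ ≡⟨ +-identityʳ (Φ []) ⟩
    Φ []      ≤⟨ Φ-initial-≤1 ⟩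
    1ℚ        ≡⟨⟩
    1ℚ * fromℕ 1 ∎
    where open ≤-Reasoning
  ∑-Φ (suc t) = begin
    ∑ (histories n (suc t)) Φ
      ≡⟨ ∑-cartesianProductWith _∷_ P H Φ ⟩
    ∑ P (λ σ → ∑ H (λ σs → Φ (σ ∷ σs)))
      -- With the past outermost, the one-round bound applies to each history separately.
      ≡⟨ ∑-swap P H (λ σ σs → Φ (σ ∷ σs)) ⟩
    ∑ H (λ σs → ∑ P (λ σ → Φ (σ ∷ σs)))
      ≤⟨ ∑-mono-≤ H ∑-Φ-round ⟩
    ∑ H (λ σs → 1/ℕ K * (p * Φ σs))
      ≡⟨ trans (∑-*ˡ H (1/ℕ K) (λ σs → p * Φ σs)) (cong (1/ℕ K *_) (∑-*ˡ H p Φ)) ⟩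
    1/ℕ K * (p * ∑ H Φ)
      ≤⟨ *-monoˡ-≤-nonNeg (1/ℕ K) {{normalize-nonNeg 1 K}}
          (*-monoˡ-≤-nonNeg p {{normalize-nonNeg (length P) 1}} (∑-Φ t)) ⟩
    1/ℕ K * (p * ((1/ℕ K) ^ t * fromℕ (length H)))
      ≡⟨ solve 4 (λ x p y h → x :* (p :* (y :* h)) := x :* y :* (p :* h)) refl
          (1/ℕ K) p ((1/ℕ K) ^ t) (fromℕ (length H)) ⟩
    (1/ℕ K) ^ suc t * (p * fromℕ (length H))
      ≡⟨ cong ((1/ℕ K) ^ suc t *_) (trans (cong fromℕ (length-cartesianProductWith _∷_ P H)) (fromℕ-* (length P) (length H))) ⟨
    (1/ℕ K) ^ suc t * fromℕ (length (histories n (suc t))) ∎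
    where
    open ≤-Reasoning
    P : List (Permutation′ n)
    P = permutations n
    H : List (Vec (Permutation′ n) t)
    H = histories n t
    p : ℚ
    p = fromℕ (length P)

  𝔼Φ≤ : ∀ t → 𝔼Φ t ≤ (1/ℕ K) ^ t
  𝔼Φ≤ t = mean-≤ (map Φ (histories n t)) (0≤p^k (0≤1/ℕ K) t)
    (subst₂ (λ qs l → foldr _+_ 0ℚ qs ≤ (1/ℕ K) ^ t * fromℕ l)
      (sym (map-id (map Φ (histories n t)))) (sym (length-map Φ (histories n t))) (∑-Φ t))

-- Real exponents

-- The hypothesis is only a negation; locatedness between ½ and 1 turns it into a positive rational
-- lower bound for `c`. Any rational strictly between 0 and 1 could replace ½.
½<c : (c : ℝ) → 1ℚ ℚ≤ cut c → lower (cut c) ½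
½<c c 1≤c with IsDedekind.located (isDedekind c) {½} {1ℚ} (from-yes (½ <? 1ℚ))
... | inj₁ ½<c = ½<c
... | inj₂ c<1 = contradiction c<1 1≤c

-- Locate c between two rationals strictly between T/b and T/p.

upper-from-product : (b c : ℝ) → ∀ {p T} → 0ℚ < p → lower (cut b) p → 0ℚ < T →
  cut b · cut c ≤ℚ T → ∃[ z ] 0ℚ < z × upper (cut c) z × p * z < T
upper-from-product b c {p} {T} 0<p p<b 0<T bc≤T =
  -- From p < y < x < r < b come the trial points s = T / x and z = T / y for c, with s < z.
  let r , p<r , r<b = IsDedekind.lower-open (isDedekind b) p<b
      x , p<x , x<r = <-dense p<r
      y , p<y , y<x = <-dense p<x
      0<x = <-trans 0<p p<x
      s , 0<s , xs≡T = divide x T 0<x 0<T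
      z , 0<z , yz≡T = divide y T (<-trans 0<p p<y) 0<T
      s<z = *-cancelˡ-<-nonNeg x {{nonNegative (<⇒≤ 0<x)}}
        (subst (_< x * z) (trans yz≡T (sym xs≡T)) (*-monoˡ-<-pos z {{positive 0<z}} y<x))
  -- If s < c, then T = x s < r s puts T below the product bc, against bc ≤ T. If c < z, then p z <
  -- y z = T.
  in [ (λ s<c → contradiction
         ( r , s , <-trans 0<x x<r , 0<s , r<b , s<c
         , subst (_< r * s) xs≡T (*-monoˡ-<-pos s {{positive 0<s}} x<r) )
         bc≤T)
     , (λ c<z → z , 0<z , c<z , subst (p * z <_) yz≡T (*-monoˡ-<-pos z {{positive 0<z}} p<y))
     ]′ (IsDedekind.located (isDedekind c) s<z)

-- The positive rationals `p` and ½ lie below b and c, so 0 is in the lower cut of bc. This excludes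
-- t = 0 as an upper bound of bc.
0<product : (b c : ℝ) → ∀ {p} → 0ℚ < p → lower (cut b) p → 1ℚ ℚ≤ cut c → ¬ (cut b · cut c ≤ℚ 0ℚ)
0<product b c {p} 0<p p<b 1≤c bc≤0 =
  bc≤0 (p , ½ , 0<p , positive⁻¹ ½ , p<b , ½<c c 1≤c , positive⁻¹ (p * ½) {{pos*pos⇒pos p {{positive 0<p}} ½}})

0<suc/suc : ∀ k m → 0ℚ < ℤ.+ suc k / suc m
0<suc/suc k m = positive⁻¹ (ℤ.+ suc k / suc m) {{normalize-pos (suc k) (suc m)}}

-- A rational z above c with p z < T, divided by T, gives (p / T) z < 1, which places p / T in the
-- lower cut of 1/c.
lower-recip : (b c : ℝ) → ∀ t → cut b · cut c ≤ℚ fromℕ (suc t) →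
  ∀ k m → lower (cut b) (ℤ.+ suc k / suc m) →
  lower (recip (cut c)) (ℤ.+ suc k / (suc t ℕ.* suc m))
lower-recip b c t bc≤t k m p<b =
  let z , 0<z , c<z , pz<T = upper-from-product b c (0<suc/suc k m) p<b (0<fromℕ (suc t)) bc≤t
  in z , c<z , cancel z pz<T
  where
  open ≤-Reasoning
  q : ℚ
  q = ℤ.+ suc k / (suc t ℕ.* suc m)
  cancel : ∀ z → (ℤ.+ suc k / suc m) * z < fromℕ (suc t) → q * z < 1ℚ
  cancel z pz<T = *-cancelˡ-<-nonNeg (fromℕ (suc t)) {{nonNegative (0≤fromℕ (suc t))}} (begin-strict
    fromℕ (suc t) * (q * z) ≡⟨ solve 3 (λ a b c → a :* (b :* c) := b :* a :* c) refl (fromℕ (suc t)) q z ⟩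
    q * fromℕ (suc t) * z   ≡⟨ cong (_* z) (/-*-numerator (suc k) t m) ⟩
    (ℤ.+ suc k / suc m) * z <⟨ pz<T ⟩
    fromℕ (suc t)           ≡⟨ *-identityʳ (fromℕ (suc t)) ⟨
    fromℕ (suc t) * 1ℚ      ∎)

-- By contradiction: if K^(tm) < n^k, then k/(tm) < 1/c makes K itself a member of the lower cut of
-- n^(1/c), against the hypothesis. The case k = 0 is separate because `lower-recip` takes a
-- positive exponent.
rational-power-bound : ∀ K n .{{_ : NonZero K}} (b c : ℝ) → 1ℚ ℚ≤ cut c →
  n ↑ recip (cut c) ≤ℚ fromℕ K → ∀ t → cut b · cut c ≤ℚ fromℕ t →
  ∀ k m → lower (cut b) (ℤ.+ k / suc m) → fromℕ n ^ k ≤ (fromℕ K ^ t) ^ suc m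
rational-power-bound K n b c 1≤c hyp t bc≤t zero    m _   =
  1≤p^k (1≤p^k (1≤fromℕ K) t) (suc m)
rational-power-bound K n b c 1≤c hyp zero bc≤0 (suc k) m p<b =
  contradiction bc≤0 (0<product b c (0<suc/suc k m) p<b 1≤c)
rational-power-bound K n b c 1≤c hyp (suc t) bc≤t (suc k) m p<b = ≮⇒≥ λ Kᵗ<nᵏ → hyp
  -- The cut stores the predecessor of the denominator, and `m ℕ.+ t ℕ.* suc m` is that of
  -- `suc t ℕ.* suc m`.
  ( fromℕ K , ≤-refl , 0≤fromℕ K , suc k , m ℕ.+ t ℕ.* suc m , lower-recip b c t bc≤t k m p<b
  , subst (_< fromℕ n ^ suc k) (^-assocʳ (fromℕ K) (suc t) (suc m)) Kᵗ<nᵏ )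

-- If e were above 1/n^b, there would be r with 1 < e r, and r′ ≥ r with r′^(m+1) < n^k for some
-- k/(m+1) < b. Multiplying 1 < e r by K^t and using e ≤ K^(-t) gives K^t ≤ r ≤ r′, and the bound
-- n^k ≤ (K^t)^(m+1) closes a strict cycle.
≤-recip-power : ∀ K n .{{_ : NonZero K}} (b c : ℝ) → 1ℚ ℚ≤ cut c →
  n ↑ recip (cut c) ≤ℚ fromℕ K → ∀ t → cut b · cut c ≤ℚ fromℕ t →
  ∀ {e} → e ≤ (1/ℕ K) ^ t → e ℚ≤ recip (n ↑ cut b)
≤-recip-power K n b c 1≤c hyp t bc≤t {e} e≤ (r , 0<r , (r′ , r≤r′ , 0≤r′ , k , m , p<b , r′<) , 1<er) =
  <-irrefl refl (begin-strict
    fromℕ n ^ k             ≤⟨ rational-power-bound K n b c 1≤c hyp t bc≤t k m p<b ⟩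
    (fromℕ K ^ t) ^ suc m   ≤⟨ ^-monoˡ-≤ (suc m) 0≤Kᵗ Kᵗ≤r′ ⟩
    r′ ^ suc m              <⟨ r′< ⟩
    fromℕ n ^ k             ∎)
  where
  open ≤-Reasoning
  0≤Kᵗ : 0ℚ ≤ fromℕ K ^ t
  0≤Kᵗ = 0≤p^k (0≤fromℕ K) t
  Kᵗ≤r′ : fromℕ K ^ t ≤ r′
  Kᵗ≤r′ = begin
    fromℕ K ^ t                      ≡⟨ *-identityʳ (fromℕ K ^ t) ⟨
    fromℕ K ^ t * 1ℚ                 ≤⟨ *-monoˡ-≤-nonNeg (fromℕ K ^ t) {{nonNegative 0≤Kᵗ}} (<⇒≤ 1<er) ⟩
    fromℕ K ^ t * (e * r)            ≤⟨ *-monoˡ-≤-nonNeg (fromℕ K ^ t) {{nonNegative 0≤Kᵗ}}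
                                          (*-monoʳ-≤-nonNeg r {{nonNegative (<⇒≤ 0<r)}} e≤) ⟩
    fromℕ K ^ t * ((1/ℕ K) ^ t * r)  ≡⟨ solve 3 (λ a b c → a :* (b :* c) := b :* a :* c) refl (fromℕ K ^ t) ((1/ℕ K) ^ t) r ⟩
    (1/ℕ K) ^ t * fromℕ K ^ t * r    ≡⟨ cong (_* r) (^-distrib-* (1/ℕ K) (fromℕ K) t) ⟨
    (1/ℕ K * fromℕ K) ^ t * r        ≡⟨ cong (λ q → q ^ t * r) (/-*-fromℕ ℤ.1ℤ K) ⟩
    1ℚ ^ t * r                       ≡⟨ cong (_* r) (1^k≡1 t) ⟩
    1ℚ * r                           ≡⟨ *-identityˡ r ⟩
    r                                ≤⟨ r≤r′ ⟩
    r′                               ∎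

theorem1 : (K M : ℕ) .{{_ : NonZero K}} .{{_ : NonZero M}} →
    let open BufferShuffle K M in
    ((t : ℕ) → 𝔼Φ t ≤ (1/ℕ K) ^ t)
    × ((b c : ℝ) → 1ℚ ℚ≤ cut b → 1ℚ ℚ≤ cut c →
    n ↑ recip (cut c) ≤ℚ fromℕ K →
    (t : ℕ) → IsCeiling (cut b · cut c) t →
    𝔼Φ t ℚ≤ recip (n ↑ cut b))
theorem1 K M = 𝔼Φ≤ K M , λ b c _ 1≤c n^1/c≤K t (_ , bc≤t) →
  ≤-recip-power K (BufferShuffle.n K M) b c 1≤c n^1/c≤K t bc≤t (𝔼Φ≤ K M t)
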